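{- Let $q$ be an odd prime power. Let $B=\bigcup_{i \in \mathbb{F}_q\cup\{\infty\}} \ell(i,b_i)$ with $b_i\in\mathbb{F}_q$, and for $P\in\mathbb{F}_q^2$ let $m_P$ be the number of indices $i\in\mathbb{F}_q\cup\{\infty\}$ with $P\in\ell(i,b_i)$. Suppose there is $j \in \mathbb{F}_q \cup \{\infty\}$ such that every point $P \in B$ with $m_P \geq 3$ lies on the line $\ell(j,b_j)$. Then \[ \sum_{P \in B} \frac{(m_P-1)(m_P-2)}{2} \geq \frac{q-1}{2}. \] Moreover, equality holds if and only if there are exactly $(q-1)/2$ points $P \in B$ with $m_P=3$ and no points $P\in B$ with $m_P > 3$.
   Context: $\mathbb{F}_q$ is the finite field with $q$ elements. For $m,b\in\mathbb{F}_q$, $\ell(m,b)$ denotes the line $\{(x,y)\in\mathbb{F}_q^2 : y=mx+b\}$, and for $a\in\mathbb{F}_q$, $\ell(\infty,a)$ denotes the vertical line $\{(x,y): x=a\}$. -}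

module Defs where

open import Data.Nat using (ℕ; suc; _+_; _*_; _∸_; _^_; _≤_; _<_; _/_; _%_; _≤?_; _≟_)
open import Data.Nat.Primality using (Prime)
open import Data.Fin using (Fin)
open import Data.Fin.Properties using () renaming (_≟_ to _≟ᶠ_)
open import Data.Maybe using (Maybe; just; nothing)
open import Data.Product using (_×_; _,_; ∃; Σ)
open import Data.List using (List; []; _∷_; map; filter; length; allFin; cartesianProduct)
open import Data.Nat.ListAction using (sum)
open import Relation.Binary.PropositionalEquality using (_≡_)
open import Relation.Nullary using (¬_; Dec)
open import Algebra.Core using (Op₁; Op₂)
open import Algebra.Structures using (IsCommutativeRing)

IsPrimePower : ℕ → Set
IsPrimePower q = ∃ λ p → ∃ λ k → Prime p × 1 ≤ k × q ≡ p ^ k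

-- A finite field with q elements, presented (up to isomorphism) with carrier Fin q
-- and propositional equality.
record FiniteField (q : ℕ) : Set where
  field
    _+F_ _*F_ : Op₂ (Fin q)
    -F_ : Op₁ (Fin q)
    0F 1F : Fin q
    isCommutativeRing : IsCommutativeRing _≡_ _+F_ _*F_ -F_ 0F 1F
    0≢1 : ¬ (0F ≡ 1F)
    inverse : ∀ x → ¬ (x ≡ 0F) → ∃ λ y → (x *F y) ≡ 1F

module _ {q : ℕ} (F : FiniteField q) where
  open FiniteField F

  Point : Set
  Point = Fin q × Fin q

  -- slopes: just m for m ∈ F_q, nothing for ∞
  Slope : Set
  Slope = Maybe (Fin q)

  OnLine : Slope → Fin q → Point → Set
  OnLine (just m) c (x , y) = y ≡ ((m *F x) +F c)
  OnLine nothing a (x , y) = x ≡ a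

  onLine? : ∀ i c P → Dec (OnLine i c P)
  onLine? (just m) c (x , y) = y ≟ᶠ ((m *F x) +F c)
  onLine? nothing a (x , y) = x ≟ᶠ a

  slopes : List Slope
  slopes = nothing ∷ map just (allFin q)

  points : List Point
  points = cartesianProduct (allFin q) (allFin q)

  mult : (Slope → Fin q) → Point → ℕ
  mult b P = length (filter (λ i → onLine? i (b i) P) slopes)

  -- B = union of the lines: points with m_P ≥ 1
  inB? : (b : Slope → Fin q) → (P : Point) → Dec (1 ≤ mult b P)
  inB? b P = 1 ≤? mult b P

  pointsOfB : (Slope → Fin q) → List Point
  pointsOfB b = filter (inB? b) points

  -- Σ_{P∈B} (m_P - 1)(m_P - 2)/2   (the numerator is always even, so ℕ division is exact)
  excess : (Slope → Fin q) → ℕ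
  excess b = sum (map (λ P → ((mult b P ∸ 1) * (mult b P ∸ 2)) / 2) (pointsOfB b))

  countMult3 : (Slope → Fin q) → ℕ
  countMult3 b = length (filter (λ P → mult b P ≟ 3) (pointsOfB b))

{-# OPTIONS --safe #-}

-- An affine change of coordinates makes the distinguished line ℓ(j, b_j) the vertical line u = a
-- and the other q lines v = t u + c t; let N(u, v) be the number of the latter through (u, v).
-- Any two of them meet exactly once, which determines Σ N². Off u = a we have N ≤ 2, hence
-- N² + [N = 1] = 2N, and each column u ≠ a contains a tangent point (N = 1), because N sums to
-- the odd number q there. Counting then gives 2 · excess = number of tangent points ≥ q - 1.
--
-- In case of equality every column u ≠ a has a unique tangent point w(u). If N(a, v) = 1, parity
-- along the lines through (a, v) shows that u ↦ (w(u) - v)/(u - a) takes every value except the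
-- slope t_v of the line of the configuration through (a, v), so its sum is - t_v. Since Σ 1/(u - a) = 0,
-- this sum does not depend on v; so at most one v has N(a, v) = 1, and comparing Σ N(a, v)² with
-- 2 Σ N(a, v) forces N(a, v) ≤ 2 for all v.
module Submission where

open import Defs
open import Data.Nat using (ℕ; _≤_; _<_; _∸_; _/_; _%_)
open import Data.Product using (_×_; ∃)
open import Data.Maybe using (Maybe)
open import Data.Fin using (Fin)
open import Relation.Binary.PropositionalEquality using (_≡_)
open import Function.Bundles using (_⇔_)
open import Relation.Nullary using (¬_)

open import Algebra.Bundles using (CommutativeMonoid; CommutativeRing)
import Algebra.Properties.CommutativeMonoid.Sum
import Algebra.Properties.Group
import Algebra.Properties.Ring
import Algebra.Properties.Semiring.Sum
open import Data.Fin using (zero; suc; punchOut)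
open import Data.Fin.Permutation using (Permutation; permutation)
open import Data.Fin.Properties using (any?; punchInᵢ≢i; punchOut-injective; injective⇒≤) renaming (_≟_ to _≟ᶠ_; suc-injective to sucᶠ-injective)
open import Data.List using (List; []; _∷_; _++_; map; filter; length; tabulate; allFin; cartesianProduct)
open import Data.List.Properties using (map-++; map-∘; map-tabulate)
open import Data.Maybe using (just; nothing)
open import Data.Nat using (zero; suc; _+_; _*_; z≤n; s≤s)
open import Data.Nat.Divisibility using (_∣_; divides; ∣m∣n⇒∣m+n; ∣m+n∣m⇒∣n; n∣m*n; ∣⇒≤; ∣-refl; _∣0)
open import Data.Nat.DivMod using (m≡m%n+[m/n]*n; m*n/n≡m)
open import Data.Nat.ListAction renaming (sum to sumᴸ)
open import Data.Nat.ListAction.Properties using (sum-++)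
open import Data.Nat.Properties
open import Data.Nat.Solver using (module +-*-Solver)
open import Data.Product using (_,_; proj₁; proj₂)
open import Data.Vec.Functional using (removeAt)
open import Function using (_∘_; id; Injective)
open import Function.Bundles using (mk⇔)
open import Level using (0ℓ)
open import Relation.Binary.PropositionalEquality using (refl; sym; trans; cong; cong₂; subst; module ≡-Reasoning)
open import Relation.Nullary using (Dec; yes; no; contradiction)
open import Relation.Nullary.Decidable using (¬?; _×-dec_)
open import Relation.Unary using (Decidable)
open Algebra.Properties.Semiring.Sum +-*-semiring

-- Sums over Fin n and over lists

private
  variable
    n : ℕ
    A : Set

module _ {c ℓ} (M : CommutativeMonoid c ℓ) where
  open CommutativeMonoid M hiding (sym; refl; trans)
  private module Σᴹ = Algebra.Properties.CommutativeMonoid.Sum M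
  open import Relation.Binary.Reasoning.Setoid setoid

  -- Adding the opposite exceptional value to each side avoids subtraction, so one exchange serves
  -- both in ℕ (trading one line for another in a multiplicity) and in the field (comparing slopes).
  sum-agree-off : (f g : Fin n → Carrier) (k : Fin n) → (∀ i → ¬ (i ≡ k) → f i ≈ g i) →
                  Σᴹ.sum f ∙ g k ≈ Σᴹ.sum g ∙ f k
  sum-agree-off {suc n} f g k agree = begin
    Σᴹ.sum f ∙ g k                       ≈⟨ ∙-congʳ (Σᴹ.sum-remove {i = k} f) ⟩
    (f k ∙ Σᴹ.sum (removeAt f k)) ∙ g k  ≈⟨ ∙-congʳ (comm _ _) ⟩
    (Σᴹ.sum (removeAt f k) ∙ f k) ∙ g k  ≈⟨ assoc _ _ _ ⟩
    Σᴹ.sum (removeAt f k) ∙ (f k ∙ g k)  ≈⟨ ∙-cong (Σᴹ.sum-cong-≋ (λ i → agree _ (punchInᵢ≢i k i))) (comm _ _) ⟩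
    Σᴹ.sum (removeAt g k) ∙ (g k ∙ f k)  ≈⟨ assoc _ _ _ ⟨
    (Σᴹ.sum (removeAt g k) ∙ g k) ∙ f k  ≈⟨ ∙-congʳ (comm _ _) ⟩
    (g k ∙ Σᴹ.sum (removeAt g k)) ∙ f k  ≈⟨ ∙-congʳ (Σᴹ.sum-remove {i = k} g) ⟨
    Σᴹ.sum g ∙ f k                       ∎

⟦_⟧ : {P : Set} → Dec P → ℕ
⟦ yes _ ⟧ = 1
⟦ no _ ⟧ = 0

⟦⟧-yes : {P : Set} (d : Dec P) → P → ⟦ d ⟧ ≡ 1
⟦⟧-yes (yes _) _ = refl
⟦⟧-yes (no ¬p) p = contradiction p ¬p

⟦⟧-no : {P : Set} (d : Dec P) → ¬ P → ⟦ d ⟧ ≡ 0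
⟦⟧-no (yes p) ¬p = contradiction p ¬p
⟦⟧-no (no _) _ = refl

⟦⟧-cong : {P Q : Set} (d : Dec P) (e : Dec Q) → (P → Q) → (Q → P) → ⟦ d ⟧ ≡ ⟦ e ⟧
⟦⟧-cong (yes p) e f g = sym (⟦⟧-yes e (f p))
⟦⟧-cong (no ¬p) e f g = sym (⟦⟧-no e (¬p ∘ g))

δ : Fin n → Fin n → ℕ
δ i j = ⟦ i ≟ᶠ j ⟧

δ-refl : (i : Fin n) → δ i i ≡ 1
δ-refl i = ⟦⟧-yes (i ≟ᶠ i) refl

δ-≢ : {i j : Fin n} → ¬ (i ≡ j) → δ i j ≡ 0
δ-≢ {i = i} {j} = ⟦⟧-no (i ≟ᶠ j)

∑-const : ∀ n k → ∑[ i < n ] k ≡ n * k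
∑-const zero k = refl
∑-const (suc n) k = cong (k +_) (∑-const n k)

∑-δ : (k : Fin n) (f : Fin n → ℕ) → ∑[ i < n ] (δ i k * f i) ≡ f k
∑-δ {suc n} zero f = begin
  f zero + 0 + ∑[ i < n ] 0  ≡⟨ cong₂ _+_ (+-identityʳ _) (sum-replicate-zero n) ⟩
  f zero + 0                 ≡⟨ +-identityʳ _ ⟩
  f zero                     ∎
  where open ≡-Reasoning
∑-δ {suc n} (suc k) f = begin
  ∑[ i < n ] (δ (suc i) (suc k) * f (suc i))  ≡⟨ sum-cong-≗ (λ i → cong (_* f (suc i)) (⟦⟧-cong (suc i ≟ᶠ suc k) (i ≟ᶠ k) sucᶠ-injective (cong suc))) ⟩
  ∑[ i < n ] (δ i k * f (suc i))              ≡⟨ ∑-δ k (f ∘ suc) ⟩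
  f (suc k)                                   ∎
  where open ≡-Reasoning

∑-δ-1 : (k : Fin n) → ∑[ i < n ] δ i k ≡ 1
∑-δ-1 k = trans (sum-cong-≗ (λ i → sym (*-identityʳ (δ i k)))) (∑-δ k (λ _ → 1))

∑-∃! : {P : Fin n → Set} (P? : ∀ i → Dec (P i)) (k : Fin n) → P k → (∀ i → P i → i ≡ k) →
       ∑[ i < n ] ⟦ P? i ⟧ ≡ 1
∑-∃! P? k Pk unique =
  trans (sum-cong-≗ (λ i → ⟦⟧-cong (P? i) (i ≟ᶠ k) (unique i) (λ { refl → Pk }))) (∑-δ-1 k)

∑-mono-≤ : (f g : Fin n → ℕ) → (∀ i → f i ≤ g i) → ∑[ i < n ] f i ≤ ∑[ i < n ] g i
∑-mono-≤ {zero} f g f≤g = z≤n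
∑-mono-≤ {suc n} f g f≤g = +-mono-≤ (f≤g zero) (∑-mono-≤ (f ∘ suc) (g ∘ suc) (f≤g ∘ suc))

≤∑ : (f : Fin n → ℕ) (i : Fin n) → f i ≤ ∑[ i < n ] f i
≤∑ f zero = m≤m+n _ _
≤∑ f (suc i) = ≤-trans (≤∑ (f ∘ suc) i) (m≤n+m _ _)

-- A strict inequality in one term could not be made up by the others: they are bounded by `f≤g` and
-- cancel.
∑-tight : (f g : Fin n → ℕ) → (∀ i → f i ≤ g i) → ∑[ i < n ] g i ≤ ∑[ i < n ] f i → ∀ i → g i ≤ f i
∑-tight {suc n} f g f≤g ∑g≤∑f zero = +-cancelʳ-≤ _ (g zero) (f zero)
  (≤-trans ∑g≤∑f (+-monoʳ-≤ (f zero) (∑-mono-≤ (f ∘ suc) (g ∘ suc) (f≤g ∘ suc))))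
∑-tight {suc n} f g f≤g ∑g≤∑f (suc i) = ∑-tight (f ∘ suc) (g ∘ suc) (f≤g ∘ suc)
  (+-cancelˡ-≤ (g zero) _ _ (≤-trans ∑g≤∑f (+-monoˡ-≤ _ (f≤g zero)))) i

∑≤1⇒≡ : (f : Fin n → ℕ) → ∑[ i < n ] f i ≤ 1 → ∀ i j → 1 ≤ f i → 1 ≤ f j → i ≡ j
∑≤1⇒≡ f ∑≤1 zero zero _ _ = refl
∑≤1⇒≡ f ∑≤1 zero (suc j) 1≤fi 1≤fj =
  contradiction (≤-trans (+-mono-≤ 1≤fi (≤-trans 1≤fj (≤∑ (f ∘ suc) j))) ∑≤1) λ { (s≤s ()) }
∑≤1⇒≡ f ∑≤1 (suc i) zero 1≤fi 1≤fj = sym (∑≤1⇒≡ f ∑≤1 zero (suc i) 1≤fj 1≤fi)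
∑≤1⇒≡ f ∑≤1 (suc i) (suc j) 1≤fi 1≤fj =
  cong suc (∑≤1⇒≡ (f ∘ suc) (≤-trans (m≤n+m _ _) ∑≤1) i j 1≤fi 1≤fj)

∑-subsingleton : {P : Fin n → Set} (P? : ∀ i → Dec (P i)) → (∀ i j → P i → P j → i ≡ j) →
                 ∑[ i < n ] ⟦ P? i ⟧ ≤ 1
∑-subsingleton {n} P? unique with any? P?
... | yes (k , Pk) = ≤-reflexive (∑-∃! P? k Pk (λ i Pi → unique i k Pi Pk))
... | no ∄ = ≤-trans (≤-reflexive (trans (sum-cong-≗ (λ i → ⟦⟧-no (P? i) (∄ ∘ (i ,_)))) (sum-replicate-zero n))) z≤n

∑-∣ : ∀ d (f : Fin n → ℕ) → (∀ i → d ∣ f i) → d ∣ ∑[ i < n ] f i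
∑-∣ {zero} d f d∣f = d ∣0
∑-∣ {suc n} d f d∣f = ∣m∣n⇒∣m+n (d∣f zero) (∑-∣ d (f ∘ suc) (d∣f ∘ suc))

-- Pigeonhole: a missed value `y` can be punched out of the codomain, which leaves an injection into
-- a smaller `Fin`.
injective⇒surjective : (f : Fin n → Fin n) → Injective _≡_ _≡_ f → ∀ y → ∃ λ x → f x ≡ y
injective⇒surjective {suc n} f inj y with any? (λ x → f x ≟ᶠ y)
... | yes hit = hit
... | no miss = contradiction
  (injective⇒≤ {f = λ x → punchOut (avoids x)} (λ {x} {x′} eq → inj (punchOut-injective (avoids x) (avoids x′) eq)))
  1+n≰n
  where
  avoids : ∀ x → ¬ (y ≡ f x)
  avoids x y≡fx = miss (x , sym y≡fx)

-- A right inverse is injective, hence surjective by finiteness, hence a two-sided inverse.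
surjective⇒permutation : (f g : Fin n → Fin n) → (∀ y → f (g y) ≡ y) → Permutation n n
surjective⇒permutation f g fg = permutation f g fg gf
  where
  gf : ∀ x → g (f x) ≡ x
  gf x with injective⇒surjective g (λ {y} {z} eq → trans (sym (fg y)) (trans (cong f eq) (fg z))) x
  ... | y , refl = cong g (fg y)

-- List sums as sums over `Fin n`

sum-tabulate : (f : Fin n → ℕ) → sumᴸ (tabulate f) ≡ ∑[ i < n ] f i
sum-tabulate {zero} f = refl
sum-tabulate {suc n} f = cong (f zero +_) (sum-tabulate (f ∘ suc))

length-filter-sum : {P : A → Set} (P? : Decidable P) (xs : List A) →
                    length (filter P? xs) ≡ sumᴸ (map (⟦_⟧ ∘ P?) xs)
length-filter-sum P? [] = refl
length-filter-sum P? (x ∷ xs) with P? x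
... | yes _ = cong suc (length-filter-sum P? xs)
... | no _ = length-filter-sum P? xs

sum-map-filter : {P : A → Set} (P? : Decidable P) (f : A → ℕ) → (∀ x → ¬ P x → f x ≡ 0) →
                 (xs : List A) → sumᴸ (map f (filter P? xs)) ≡ sumᴸ (map f xs)
sum-map-filter P? f f≡0 [] = refl
sum-map-filter P? f f≡0 (x ∷ xs) with P? x
... | yes _ = cong (f x +_) (sum-map-filter P? f f≡0 xs)
... | no ¬Px rewrite f≡0 x ¬Px = sum-map-filter P? f f≡0 xs

sum-map-cartesianProduct : {B : Set} (f : A × B → ℕ) (xs : List A) (ys : List B) →
  sumᴸ (map f (cartesianProduct xs ys)) ≡ sumᴸ (map (λ x → sumᴸ (map (λ y → f (x , y)) ys)) xs)
sum-map-cartesianProduct f [] ys = refl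
sum-map-cartesianProduct f (x ∷ xs) ys = begin
  sumᴸ (map f (map (x ,_) ys ++ cartesianProduct xs ys))
    ≡⟨ cong sumᴸ (map-++ f (map (x ,_) ys) _) ⟩
  sumᴸ (map f (map (x ,_) ys) ++ map f (cartesianProduct xs ys))
    ≡⟨ sum-++ (map f (map (x ,_) ys)) _ ⟩
  sumᴸ (map f (map (x ,_) ys)) + sumᴸ (map f (cartesianProduct xs ys))
    ≡⟨ cong₂ _+_ (cong sumᴸ (sym (map-∘ ys))) (sum-map-cartesianProduct f xs ys) ⟩
  sumᴸ (map (λ y → f (x , y)) ys) + sumᴸ (map (λ x → sumᴸ (map (λ y → f (x , y)) ys)) xs) ∎
  where open ≡-Reasoning

-- Contribution of a single point

-- Truncated subtraction makes defect 0 = 0, so points outside B do not contribute.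
defect : ℕ → ℕ
defect m = ((m ∸ 1) * (m ∸ 2)) / 2

n[n∸1]-even : ∀ n → ∃ λ k → n * (n ∸ 1) ≡ k * 2
n[n∸1]-even zero = 0 , refl
n[n∸1]-even (suc zero) = 0 , refl
n[n∸1]-even (suc (suc n)) with n[n∸1]-even (suc n)
... | k , eq = suc n + k , (begin
  suc (suc n) * suc n         ≡⟨ solve 1 (λ n → (con 2 :+ n) :* (con 1 :+ n) := (con 1 :+ n) :* con 2 :+ (con 1 :+ n) :* n) refl n ⟩
  suc n * 2 + suc n * n       ≡⟨ cong (suc n * 2 +_) eq ⟩
  suc n * 2 + k * 2           ≡⟨ *-distribʳ-+ 2 (suc n) k ⟨
  (suc n + k) * 2             ∎)
  where
  open ≡-Reasoning
  open +-*-Solver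

-- For multiplicity n + 1 the defect is n(n - 1)/2, exact because n(n - 1) is even. This is the case
-- of a point on the distinguished line and on `n` others.
defect-suc : ∀ n → n * n ≡ n + defect (suc n) * 2
defect-suc n with n[n∸1]-even n
... | k , eq = trans (square n) (cong (n +_) (trans eq (cong (_* 2) (sym (trans (cong (_/ 2) eq) (m*n/n≡m k 2))))))
  where
  square : ∀ n → n * n ≡ n + n * (n ∸ 1)
  square zero = refl
  square (suc n) = *-suc (suc n) n

defect≡⟦≡3⟧ : ∀ m → m ≤ 3 → defect m ≡ ⟦ m ≟ 3 ⟧
defect≡⟦≡3⟧ 0 _ = refl
defect≡⟦≡3⟧ 1 _ = refl
defect≡⟦≡3⟧ 2 _ = refl
defect≡⟦≡3⟧ 3 _ = refl
defect≡⟦≡3⟧ (suc (suc (suc (suc _)))) (s≤s (s≤s (s≤s ())))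

-- Finite fields of odd order

module FieldProperties {q : ℕ} (F : FiniteField q) where
  open FiniteField F public
    using (0F; 1F; 0≢1)
    renaming (_+F_ to infixl 6 _⊕_; _*F_ to infixl 7 _⊗_; -F_ to infix 8 ⊖_)

  ring : CommutativeRing 0ℓ 0ℓ
  ring = record { isCommutativeRing = FiniteField.isCommutativeRing F }

  module R = CommutativeRing ring
  module RP = Algebra.Properties.Ring R.ring
  module GP = Algebra.Properties.Group R.+-group
  module ΣF = Algebra.Properties.Semiring.Sum R.semiring

  infixl 6 _⊝_
  _⊝_ : Fin q → Fin q → Fin q
  x ⊝ y = x ⊕ ⊖ y

  ⊝-⊕ : ∀ x y → (x ⊝ y) ⊕ y ≡ x
  ⊝-⊕ x y = GP.//-rightDividesˡ y x

  ⊕-⊝ : ∀ x y → (x ⊕ y) ⊝ y ≡ x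
  ⊕-⊝ x y = GP.//-rightDividesʳ y x

  ⊕-⊝′ : ∀ x y → y ⊕ (x ⊝ y) ≡ x
  ⊕-⊝′ x y = trans (R.+-comm y _) (⊝-⊕ x y)

  ⊕-cancelʳ : ∀ z x y → x ⊕ z ≡ y ⊕ z → x ≡ y
  ⊕-cancelʳ z x y = RP.+-cancelʳ z x y

  ⊝-telescope : ∀ x y z → x ⊝ z ≡ (x ⊝ y) ⊕ (y ⊝ z)
  ⊝-telescope x y z = sym (trans (sym (R.+-assoc (x ⊝ y) y (⊖ z))) (cong (_⊝ z) (⊝-⊕ x y)))

  ⊝≢0 : ∀ {x y} → ¬ (x ≡ y) → ¬ (x ⊝ y ≡ 0F)
  ⊝≢0 {x} {y} x≢y = x≢y ∘ GP.x∙y⁻¹≈ε⇒x≈y x y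

  inv-dec : ∀ x → Dec (x ≡ 0F) → Fin q
  inv-dec x (yes _) = 0F
  inv-dec x (no x≢0) = proj₁ (FiniteField.inverse F x x≢0)

  -- inv 0F = 0F, which makes inv a permutation of the field.
  inv : Fin q → Fin q
  inv x = inv-dec x (x ≟ᶠ 0F)

  inv-0 : inv 0F ≡ 0F
  inv-0 with 0F ≟ᶠ 0F
  ... | yes _ = refl
  ... | no 0≢0 = contradiction refl 0≢0

  ⊗-inv : ∀ {x} → ¬ (x ≡ 0F) → x ⊗ inv x ≡ 1F
  ⊗-inv {x} x≢0 with x ≟ᶠ 0F
  ... | yes x≡0 = contradiction x≡0 x≢0
  ... | no x≢0′ = proj₂ (FiniteField.inverse F x x≢0′)

  ⊗-inv-cancel : ∀ {x} → ¬ (x ≡ 0F) → ∀ y → x ⊗ (inv x ⊗ y) ≡ y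
  ⊗-inv-cancel {x} x≢0 y =
    trans (sym (R.*-assoc x (inv x) y)) (trans (cong (_⊗ y) (⊗-inv x≢0)) (R.*-identityˡ y))

  inv-⊗-cancel : ∀ {x} → ¬ (x ≡ 0F) → ∀ y → inv x ⊗ (x ⊗ y) ≡ y
  inv-⊗-cancel {x} x≢0 y =
    trans (sym (R.*-assoc (inv x) x y))
      (trans (cong (_⊗ y) (trans (R.*-comm (inv x) x) (⊗-inv x≢0))) (R.*-identityˡ y))

  inv≢0 : ∀ {x} → ¬ (x ≡ 0F) → ¬ (inv x ≡ 0F)
  inv≢0 {x} x≢0 eq = 0≢1 (trans (sym (R.zeroʳ x)) (trans (cong (x ⊗_) (sym eq)) (⊗-inv x≢0)))

  inv-involutive : ∀ x → inv (inv x) ≡ x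
  inv-involutive x = cases (x ≟ᶠ 0F)
    where
    open ≡-Reasoning
    cases : Dec (x ≡ 0F) → inv (inv x) ≡ x
    cases (yes refl) = trans (cong inv inv-0) inv-0
    cases (no x≢0) = begin
      inv (inv x)                ≡⟨ ⊗-inv-cancel x≢0 (inv (inv x)) ⟨
      x ⊗ (inv x ⊗ inv (inv x))  ≡⟨ cong (x ⊗_) (⊗-inv (inv≢0 x≢0)) ⟩
      x ⊗ 1F                     ≡⟨ R.*-identityʳ x ⟩
      x                          ∎

  linear-solution : ∀ {k} → ¬ (k ≡ 0F) → ∀ d e → k ⊗ (inv k ⊗ (e ⊝ d)) ⊕ d ≡ e
  linear-solution k≢0 d e = trans (cong (_⊕ d) (⊗-inv-cancel k≢0 (e ⊝ d))) (⊝-⊕ e d)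

  linear-injective : ∀ {k} → ¬ (k ≡ 0F) → ∀ d x y → k ⊗ x ⊕ d ≡ k ⊗ y ⊕ d → x ≡ y
  linear-injective {k} k≢0 d x y eq =
    trans (sym (inv-⊗-cancel k≢0 x))
      (trans (cong (inv k ⊗_) (⊕-cancelʳ d _ _ eq)) (inv-⊗-cancel k≢0 y))

  -- Isolating the common term `t ⊗ x` reduces the intersection of two lines to one linear equation
  -- with coefficient `s ⊝ t`.
  slope-split : ∀ s t x d → s ⊗ x ⊕ d ≡ ((s ⊝ t) ⊗ x ⊕ d) ⊕ t ⊗ x
  slope-split s t x d = begin
    s ⊗ x ⊕ d                        ≡⟨ cong (λ s → s ⊗ x ⊕ d) (⊝-⊕ s t) ⟨
    ((s ⊝ t) ⊕ t) ⊗ x ⊕ d            ≡⟨ cong (_⊕ d) (R.distribʳ x (s ⊝ t) t) ⟩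
    (s ⊝ t) ⊗ x ⊕ t ⊗ x ⊕ d          ≡⟨ R.+-assoc _ _ _ ⟩
    (s ⊝ t) ⊗ x ⊕ (t ⊗ x ⊕ d)        ≡⟨ cong ((s ⊝ t) ⊗ x ⊕_) (R.+-comm _ _) ⟩
    (s ⊝ t) ⊗ x ⊕ (d ⊕ t ⊗ x)        ≡⟨ R.+-assoc _ _ _ ⟨
    (s ⊝ t) ⊗ x ⊕ d ⊕ t ⊗ x          ∎
    where open ≡-Reasoning

  lines-meet-once : ∀ {s t} → ¬ (s ≡ t) → ∀ d e →
                    ∑[ x < q ] δ (s ⊗ x ⊕ d) (t ⊗ x ⊕ e) ≡ 1
  lines-meet-once {s} {t} s≢t d e = ∑-∃! (λ x → (s ⊗ x ⊕ d) ≟ᶠ (t ⊗ x ⊕ e)) x₀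
    (trans (slope-split s t x₀ d) (trans (cong (_⊕ t ⊗ x₀) (linear-solution k≢0 d e)) (R.+-comm e _)))
    λ x eq → linear-injective k≢0 d x x₀
      (trans (⊕-cancelʳ (t ⊗ x) _ e (trans (sym (slope-split s t x d)) (trans eq (R.+-comm _ e))))
        (sym (linear-solution k≢0 d e)))
    where
    k≢0 = ⊝≢0 s≢t
    x₀ = inv (s ⊝ t) ⊗ (e ⊝ d)

  translation : Fin q → Permutation q q
  translation k = permutation (_⊕ k) (_⊝ k) (λ x → ⊝-⊕ x k) (λ x → ⊕-⊝ x k)

  negation : Permutation q q
  negation = permutation ⊖_ ⊖_ GP.⁻¹-involutive GP.⁻¹-involutive

  -- The map x ↦ 1/(x - a), completed by sending `a` to 0.
  inversion-about : Fin q → Permutation q q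
  inversion-about a = permutation (λ x → inv (x ⊝ a)) (λ y → inv y ⊕ a)
    (λ y → trans (cong inv (⊕-⊝ (inv y) a)) (inv-involutive y))
    (λ x → trans (cong (_⊕ a) (inv-involutive (x ⊝ a))) (⊝-⊕ x a))

  -- Parametrises the slopes as j + 1/t, with the slope `j` itself at t = 0.
  translated-inversion : Fin q → Permutation q q
  translated-inversion j = permutation (λ x → j ⊕ inv x) (λ y → inv (y ⊝ j))
    (λ y → trans (cong (j ⊕_) (inv-involutive (y ⊝ j))) (⊕-⊝′ y j))
    (λ x → trans (cong (λ z → inv (z ⊝ j)) (R.+-comm j (inv x))) (trans (cong inv (⊕-⊝ (inv x) j)) (inv-involutive x)))

  odd-multiple : ∀ h x → x ⊕ x ≡ 0F → ΣF.sum {suc (h * 2)} (λ _ → x) ≡ x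
  odd-multiple zero x x+x≡0 = R.+-identityʳ x
  odd-multiple (suc h) x x+x≡0 =
    trans (sym (R.+-assoc x x _)) (trans (cong (_⊕ ΣF.sum {suc (h * 2)} (λ _ → x)) x+x≡0)
      (trans (R.+-identityˡ _) (odd-multiple h x x+x≡0)))

  module _ (h : ℕ) (q≡1+2h : q ≡ suc (h * 2)) where

    -- Reindexing Σ x by x ↦ x + 1 shows q · 1 = 0, so an odd q excludes 1 + 1 = 0.
    1+1≢0 : ¬ (1F ⊕ 1F ≡ 0F)
    1+1≢0 1+1≡0 = 0≢1 (trans (sym q·1≡0) (q·1≡1 q≡1+2h))
      where
      q·1≡1 : ∀ {n} → n ≡ suc (h * 2) → ΣF.sum {n} (λ _ → 1F) ≡ 1F
      q·1≡1 refl = odd-multiple h 1F 1+1≡0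
      q·1≡0 : ΣF.sum {q} (λ _ → 1F) ≡ 0F
      q·1≡0 = RP.+-cancelˡ (ΣF.sum id) _ _
        (trans (sym (ΣF.∑-distrib-+ id (λ _ → 1F)))
          (trans (sym (ΣF.sum-permute id (translation 1F))) (sym (R.+-identityʳ _))))

    -- Negation permutes the field, so S + S = 0, and 1 + 1 is invertible.
    sum-field≡0 : ΣF.sum {q} id ≡ 0F
    sum-field≡0 = begin
      S                                  ≡⟨ inv-⊗-cancel 1+1≢0 S ⟨
      inv (1F ⊕ 1F) ⊗ ((1F ⊕ 1F) ⊗ S)    ≡⟨ cong (inv (1F ⊕ 1F) ⊗_) (trans (R.distribʳ S 1F 1F) (trans (cong₂ _⊕_ (R.*-identityˡ S) (R.*-identityˡ S)) S+S≡0)) ⟩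
      inv (1F ⊕ 1F) ⊗ 0F                 ≡⟨ R.zeroʳ _ ⟩
      0F                                 ∎
      where
      open ≡-Reasoning
      S = ΣF.sum {q} id
      S+S≡0 : S ⊕ S ≡ 0F
      S+S≡0 = begin
        S ⊕ S                         ≡⟨ cong (S ⊕_) (ΣF.sum-permute id negation) ⟩
        S ⊕ ΣF.sum ⊖_                 ≡⟨ ΣF.∑-distrib-+ id ⊖_ ⟨
        ΣF.sum (λ x → x ⊕ ⊖ x)        ≡⟨ ΣF.sum-cong-≗ R.-‿inverseʳ ⟩
        ΣF.sum {q} (λ _ → 0F)         ≡⟨ ΣF.sum-replicate-zero q ⟩
        0F                            ∎

    sum-scaled-inverses≡0 : ∀ k a → ΣF.sum (λ x → k ⊗ inv (x ⊝ a)) ≡ 0F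
    sum-scaled-inverses≡0 k a = begin
      ΣF.sum (λ x → k ⊗ inv (x ⊝ a))   ≡⟨ ΣF.*-distribˡ-sum k (λ x → inv (x ⊝ a)) ⟨
      k ⊗ ΣF.sum (λ x → inv (x ⊝ a))   ≡⟨ cong (k ⊗_) (ΣF.sum-permute id (inversion-about a)) ⟨
      k ⊗ ΣF.sum id                    ≡⟨ cong (k ⊗_) sum-field≡0 ⟩
      k ⊗ 0F                           ≡⟨ R.zeroʳ k ⟩
      0F                               ∎
      where open ≡-Reasoning

-- One line v = t u + c t for every slope t

1+2h-odd : ∀ h → ¬ (2 ∣ suc (h * 2))
1+2h-odd h 2∣ = contradiction (∣⇒≤ (∣m+n∣m⇒∣n (subst (2 ∣_) (+-comm 1 (h * 2)) 2∣) (n∣m*n h))) λ { (s≤s ()) }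

≤2∧≢1⇒even : ∀ {n} → n ≤ 2 → ¬ (n ≡ 1) → 2 ∣ n
≤2∧≢1⇒even {0} _ _ = 2 ∣0
≤2∧≢1⇒even {1} _ n≢1 = contradiction refl n≢1
≤2∧≢1⇒even {2} _ _ = ∣-refl
≤2∧≢1⇒even {suc (suc (suc _))} (s≤s (s≤s ())) _

-- The defect vanishes for n ≤ 2; it is kept so that points on and off the line u = a satisfy
-- formulas of the same shape.
≤2-square : ∀ {n} → n ≤ 2 → n * n + ⟦ n ≟ 1 ⟧ ≡ n + n + defect n * 2
≤2-square {0} _ = refl
≤2-square {1} _ = refl
≤2-square {2} _ = refl
≤2-square {suc (suc (suc _))} (s≤s (s≤s ()))

-- The square falls short of 2n only at n = 1, and there the indicator makes up the difference.
2n≤n²+⟦n≡1⟧ : ∀ n → n + n ≤ n * n + ⟦ n ≟ 1 ⟧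
2n≤n²+⟦n≡1⟧ 0 = z≤n
2n≤n²+⟦n≡1⟧ 1 = ≤-refl
2n≤n²+⟦n≡1⟧ (suc (suc n)) = ≤-trans (subst (_≤ m * m) (cong (m +_) (+-identityʳ m)) (*-monoˡ-≤ m (s≤s (s≤s (z≤n {n}))))) (m≤m+n _ _)
  where m = suc (suc n)

n²+⟦n≡1⟧≤2n⇒n≤2 : ∀ n → n * n + ⟦ n ≟ 1 ⟧ ≤ n + n → n ≤ 2
n²+⟦n≡1⟧≤2n⇒n≤2 0 _ = z≤n
n²+⟦n≡1⟧≤2n⇒n≤2 1 _ = s≤s z≤n
n²+⟦n≡1⟧≤2n⇒n≤2 m@(suc (suc n)) le =
  *-cancelʳ-≤ m 2 m (≤-trans (m≤m+n _ _) (≤-trans le (≤-reflexive (cong (m +_) (sym (+-identityʳ m))))))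

-- Double counting of incidences

module LineCounting {q : ℕ} (F : FiniteField q) (c : Fin q → Fin q) where
  open FieldProperties F

  N : Fin q → Fin q → ℕ
  N u v = ∑[ t < q ] δ v (t ⊗ u ⊕ c t)

  ∑-column : ∀ u → ∑[ v < q ] N u v ≡ q
  ∑-column u = begin
    ∑[ v < q ] ∑[ t < q ] δ v (t ⊗ u ⊕ c t)  ≡⟨ ∑-comm (λ v t → δ v (t ⊗ u ⊕ c t)) ⟩
    ∑[ t < q ] ∑[ v < q ] δ v (t ⊗ u ⊕ c t)  ≡⟨ sum-cong-≗ (λ t → ∑-δ-1 (t ⊗ u ⊕ c t)) ⟩
    ∑[ t < q ] 1                             ≡⟨ ∑-const q 1 ⟩
    q * 1                                    ≡⟨ *-identityʳ q ⟩
    q                                        ∎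
    where open ≡-Reasoning

  -- Each of the q - 1 lines of slope other than `s` meets v = s u + d once. The line of slope `s`
  -- is either disjoint from it or equal to it, and then adds `q`. The 1 on the left stands for the
  -- slope `s` and avoids subtraction.
  ∑-line : ∀ s d → ∑[ u < q ] N u (s ⊗ u ⊕ d) + 1 ≡ q + q * δ d (c s)
  ∑-line s d = begin
    ∑[ u < q ] N u (s ⊗ u ⊕ d) + 1            ≡⟨ cong (_+ 1) (∑-comm (λ u t → δ (s ⊗ u ⊕ d) (t ⊗ u ⊕ c t))) ⟩
    ∑[ t < q ] I t + 1                        ≡⟨ cong (sum I +_) (∑-δ-1 s) ⟨
    ∑[ t < q ] I t + ∑[ t < q ] δ t s         ≡⟨ ∑-distrib-+ I (λ t → δ t s) ⟨
    ∑[ t < q ] (I t + δ t s)                  ≡⟨ sum-cong-≗ pointwise ⟩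
    ∑[ t < q ] (1 + δ t s * (q * δ d (c s)))  ≡⟨ ∑-distrib-+ {q} (λ _ → 1) (λ t → δ t s * (q * δ d (c s))) ⟩
    ∑[ t < q ] 1 + ∑[ t < q ] (δ t s * (q * δ d (c s)))
      ≡⟨ cong₂ _+_ (trans (∑-const q 1) (*-identityʳ q)) (∑-δ s (λ _ → q * δ d (c s))) ⟩
    q + q * δ d (c s)                         ∎
    where
    open ≡-Reasoning
    I : Fin q → ℕ
    I t = ∑[ u < q ] δ (s ⊗ u ⊕ d) (t ⊗ u ⊕ c t)
    I-self : I s ≡ q * δ d (c s)
    I-self = trans
      (sum-cong-≗ (λ u → ⟦⟧-cong ((s ⊗ u ⊕ d) ≟ᶠ (s ⊗ u ⊕ c s)) (d ≟ᶠ c s) (RP.+-cancelˡ (s ⊗ u) d (c s)) (cong (s ⊗ u ⊕_))))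
      (∑-const q (δ d (c s)))
    cases : ∀ t → Dec (t ≡ s) → I t + δ t s ≡ 1 + δ t s * (q * δ d (c s))
    cases t (yes refl) rewrite δ-refl s =
      trans (cong (_+ 1) I-self) (trans (+-comm _ 1) (cong suc (sym (+-identityʳ _))))
    cases t (no t≢s) rewrite δ-≢ t≢s = trans (+-identityʳ (I t)) (lines-meet-once (t≢s ∘ sym) d (c t))
    pointwise : ∀ t → I t + δ t s ≡ 1 + δ t s * (q * δ d (c s))
    pointwise t = cases t (t ≟ᶠ s)

  -- One factor of the square is expanded as a count of lines; after exchanging the sums, each line
  -- picks out its own point of the column.
  ∑-column-squares : ∀ u → ∑[ v < q ] (N u v * N u v) ≡ ∑[ t < q ] N u (t ⊗ u ⊕ c t)
  ∑-column-squares u = begin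
    ∑[ v < q ] (N u v * N u v)                            ≡⟨ sum-cong-≗ (λ v → *-distribʳ-sum (N u v) (λ t → δ v (t ⊗ u ⊕ c t))) ⟩
    ∑[ v < q ] ∑[ t < q ] (δ v (t ⊗ u ⊕ c t) * N u v)     ≡⟨ ∑-comm (λ v t → δ v (t ⊗ u ⊕ c t) * N u v) ⟩
    ∑[ t < q ] ∑[ v < q ] (δ v (t ⊗ u ⊕ c t) * N u v)     ≡⟨ sum-cong-≗ (λ t → ∑-δ (t ⊗ u ⊕ c t) (N u)) ⟩
    ∑[ t < q ] N u (t ⊗ u ⊕ c t)                          ∎
    where open ≡-Reasoning

  -- `∑-line` applied to the lines of the configuration themselves gives 2q - 1 incidences for each
  -- of the `q` lines.
  ∑-squares : ∑[ u < q ] ∑[ v < q ] (N u v * N u v) + q ≡ q * (q + q)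
  ∑-squares = begin
    ∑[ u < q ] ∑[ v < q ] (N u v * N u v) + q               ≡⟨ cong (_+ q) (sum-cong-≗ ∑-column-squares) ⟩
    ∑[ u < q ] ∑[ t < q ] N u (t ⊗ u ⊕ c t) + q             ≡⟨ cong (_+ q) (∑-comm (λ u t → N u (t ⊗ u ⊕ c t))) ⟩
    ∑[ t < q ] L t + q                                      ≡⟨ cong (sum L +_) (trans (∑-const q 1) (*-identityʳ q)) ⟨
    ∑[ t < q ] L t + ∑[ t < q ] 1                           ≡⟨ ∑-distrib-+ L (λ _ → 1) ⟨
    ∑[ t < q ] (L t + 1)                                    ≡⟨ sum-cong-≗ (λ t → trans (∑-line t (c t)) (cong (q +_) (trans (cong (q *_) (δ-refl (c t))) (*-identityʳ q)))) ⟩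
    ∑[ t < q ] (q + q)                                      ≡⟨ ∑-const q (q + q) ⟩
    q * (q + q)                                             ∎
    where
    open ≡-Reasoning
    L : Fin q → ℕ
    L t = ∑[ u < q ] N u (t ⊗ u ⊕ c t)

  -- The vertical line u = a is not counted by N: the multiplicity of (u , v) is δ u a + N u v.
  module Bound (h : ℕ) (q≡1+2h : q ≡ suc (h * 2)) (a : Fin q)
               (N≤2 : ∀ u v → ¬ (u ≡ a) → N u v ≤ 2) where

    q-odd : ¬ (2 ∣ q)
    q-odd = subst (λ n → ¬ (2 ∣ n)) (sym q≡1+2h) (1+2h-odd h)

    totalDefect : ℕ
    totalDefect = ∑[ u < q ] ∑[ v < q ] defect (δ u a + N u v)

    -- Off u = a the weight marks the tangent points; on u = a it is chosen so that
    -- squares-and-weights holds uniformly.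
    weigh : {P : Set} → Dec P → ℕ → ℕ
    weigh (yes _) n = n
    weigh (no _) n = ⟦ n ≟ 1 ⟧

    weight : Fin q → Fin q → ℕ
    weight u v = weigh (u ≟ᶠ a) (N u v)

    weight-≢ : ∀ {u} → ¬ (u ≡ a) → ∀ v → weight u v ≡ ⟦ N u v ≟ 1 ⟧
    weight-≢ {u} u≢a v with u ≟ᶠ a
    ... | yes u≡a = contradiction u≡a u≢a
    ... | no _ = refl

    weight-a : ∀ v → weight a v ≡ N a v
    weight-a v with a ≟ᶠ a
    ... | yes _ = refl
    ... | no a≢a = contradiction refl a≢a

    -- On u = a the multiplicity is one more than `N`, so `defect-suc` applies and the weight
    -- `N u v` supplies the second copy of `N u v`. Elsewhere it is `≤2-square`.
    squares-and-weights : ∀ u v → N u v * N u v + weight u v ≡ N u v + N u v + defect (δ u a + N u v) * 2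
    squares-and-weights u v with u ≟ᶠ a
    ... | yes _ = trans (cong (_+ N u v) (defect-suc (N u v))) (solve 2 (λ n d → n :+ d :+ n := n :+ n :+ d) refl (N u v) _)
      where open +-*-Solver
    ... | no u≢a = ≤2-square (N≤2 u v u≢a)

    ∑weight : Fin q → ℕ
    ∑weight u = ∑[ v < q ] weight u v

    -- Summing `squares-and-weights` over the plane, the terms N + N give 2q², which exceeds the sum
    -- of squares by exactly `q`.
    ∑-weights : ∑[ u < q ] ∑weight u ≡ q + totalDefect * 2
    ∑-weights = +-cancelˡ-≡ squares _ _ (begin
      squares + ∑[ u < q ] ∑weight u
        ≡⟨ ∑-distrib-+ (λ u → ∑[ v < q ] (N u v * N u v)) ∑weight ⟨
      ∑[ u < q ] (∑[ v < q ] (N u v * N u v) + ∑weight u)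
        ≡⟨ sum-cong-≗ (λ u → trans (sym (∑-distrib-+ (λ v → N u v * N u v) (weight u))) (sum-cong-≗ (squares-and-weights u))) ⟩
      ∑[ u < q ] ∑[ v < q ] (N u v + N u v + defect (δ u a + N u v) * 2)
        ≡⟨ sum-cong-≗ split ⟩
      ∑[ u < q ] (q + q + (∑[ v < q ] defect (δ u a + N u v)) * 2)
        ≡⟨ ∑-distrib-+ (λ _ → q + q) (λ u → (∑[ v < q ] defect (δ u a + N u v)) * 2) ⟩
      ∑[ u < q ] (q + q) + ∑[ u < q ] ((∑[ v < q ] defect (δ u a + N u v)) * 2)
        ≡⟨ cong₂ _+_ (trans (∑-const q (q + q)) (sym ∑-squares)) (sym (*-distribʳ-sum 2 (λ u → ∑[ v < q ] defect (δ u a + N u v)))) ⟩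
      squares + q + totalDefect * 2
        ≡⟨ +-assoc squares q _ ⟩
      squares + (q + totalDefect * 2) ∎)
      where
      open ≡-Reasoning
      squares = ∑[ u < q ] ∑[ v < q ] (N u v * N u v)
      split : ∀ u → ∑[ v < q ] (N u v + N u v + defect (δ u a + N u v) * 2)
                  ≡ q + q + (∑[ v < q ] defect (δ u a + N u v)) * 2
      split u = trans (∑-distrib-+ (λ v → N u v + N u v) (λ v → defect (δ u a + N u v) * 2))
        (cong₂ _+_ (trans (∑-distrib-+ (N u) (N u)) (cong₂ _+_ (∑-column u) (∑-column u)))
          (sym (*-distribʳ-sum 2 (λ v → defect (δ u a + N u v)))))

    -- At u = a this is 1 + 2h = q, the exact weight of that column; elsewhere it is 1, for the
    -- tangent point forced by parity.
    minWeight : Fin q → ℕ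
    minWeight u = 1 + δ u a * (h * 2)

    ∑-minWeight : ∑[ u < q ] minWeight u ≡ q + h * 2
    ∑-minWeight = trans (∑-distrib-+ {q} (λ _ → 1) (λ u → δ u a * (h * 2)))
      (cong₂ _+_ (trans (∑-const q 1) (*-identityʳ q)) (∑-δ a (λ _ → h * 2)))

    minWeight-≢ : ∀ {u} → ¬ (u ≡ a) → minWeight u ≡ 1
    minWeight-≢ u≢a = cong (λ k → 1 + k * (h * 2)) (δ-≢ u≢a)

    -- N u takes the values 0, 1, 2 and has the odd sum q.
    column-tangent : ∀ {u} → ¬ (u ≡ a) → ∃ λ v → N u v ≡ 1
    column-tangent {u} u≢a with any? (λ v → N u v ≟ 1)
    ... | yes tangent = tangent
    ... | no none = contradiction
      (subst (2 ∣_) (∑-column u) (∑-∣ 2 (N u) (λ v → ≤2∧≢1⇒even (N≤2 u v u≢a) (none ∘ (v ,_))))) q-odd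

    minWeight≤∑weight : ∀ u → minWeight u ≤ ∑weight u
    minWeight≤∑weight u = cases (u ≟ᶠ a)
      where
      cases : Dec (u ≡ a) → minWeight u ≤ ∑weight u
      cases (yes refl) = ≤-reflexive (trans (cong suc (trans (cong (_* (h * 2)) (δ-refl a)) (+-identityʳ _)))
        (trans (sym q≡1+2h) (sym (trans (sum-cong-≗ weight-a) (∑-column a)))))
      cases (no u≢a) with column-tangent u≢a
      ... | v , N≡1 = ≤-trans
        (≤-reflexive (trans (minWeight-≢ u≢a) (sym (trans (weight-≢ u≢a v) (⟦⟧-yes (N u v ≟ 1) N≡1)))))
        (≤∑ (weight u) v)

    h≤totalDefect : h ≤ totalDefect
    h≤totalDefect = *-cancelʳ-≤ h totalDefect 2 (+-cancelˡ-≤ q _ _ (begin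
      q + h * 2                ≡⟨ ∑-minWeight ⟨
      ∑[ u < q ] minWeight u   ≤⟨ ∑-mono-≤ minWeight ∑weight minWeight≤∑weight ⟩
      ∑[ u < q ] ∑weight u     ≡⟨ ∑-weights ⟩
      q + totalDefect * 2      ∎))
      where open ≤-Reasoning

    -- The case of equality

    module Equality (totalDefect≡h : totalDefect ≡ h) where

      -- Both functions now have the total q + 2h, so no column can exceed its minimum.
      ∑weight≤minWeight : ∀ u → ∑weight u ≤ minWeight u
      ∑weight≤minWeight = ∑-tight minWeight ∑weight minWeight≤∑weight
        (≤-reflexive (trans ∑-weights (trans (cong (λ e → q + e * 2) totalDefect≡h) (sym ∑-minWeight))))

      tangent-unique : ∀ {u} → ¬ (u ≡ a) → ∀ v v′ → N u v ≡ 1 → N u v′ ≡ 1 → v ≡ v′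
      tangent-unique {u} u≢a v v′ p p′ =
        ∑≤1⇒≡ (weight u) (≤-trans (∑weight≤minWeight u) (≤-reflexive (minWeight-≢ u≢a))) v v′ (positive v p) (positive v′ p′)
        where
        positive : ∀ v → N u v ≡ 1 → 1 ≤ weight u v
        positive v p = ≤-reflexive (sym (trans (weight-≢ u≢a v) (⟦⟧-yes (N u v ≟ 1) p)))

      -- The value at u = a is junk.
      tangent : Fin q → Fin q
      tangent u with u ≟ᶠ a
      ... | yes _ = 0F
      ... | no u≢a = proj₁ (column-tangent u≢a)

      tangent-≡ : ∀ {u} → ¬ (u ≡ a) → ∀ v → N u v ≡ 1 → tangent u ≡ v
      tangent-≡ {u} u≢a v p with u ≟ᶠ a
      ... | yes u≡a = contradiction u≡a u≢a
      ... | no u≢a′ = tangent-unique u≢a _ v (proj₂ (column-tangent u≢a′)) p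

      module SimplePoint (v : Fin q) (simple : N a v ≡ 1) where

        line-through : ∃ λ t → v ≡ t ⊗ a ⊕ c t
        line-through with any? (λ t → v ≟ᶠ (t ⊗ a ⊕ c t))
        ... | yes found = found
        ... | no none = contradiction
          (trans (sym simple) (trans (sum-cong-≗ (λ t → δ-≢ (none ∘ (t ,_)))) (sum-replicate-zero q)))
          λ ()

        t₀ : Fin q
        t₀ = proj₁ line-through

        t₀-unique : ∀ t → v ≡ t ⊗ a ⊕ c t → t₀ ≡ t
        t₀-unique t v≡ = ∑≤1⇒≡ (λ t → δ v (t ⊗ a ⊕ c t)) (≤-reflexive simple) t₀ t
          (positive (proj₂ line-through)) (positive v≡)
          where
          positive : ∀ {y} → v ≡ y → 1 ≤ δ v y
          positive {y} v≡y = ≤-reflexive (sym (⟦⟧-yes (v ≟ᶠ y) v≡y))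

        slopeIf : ∀ {u} → Dec (u ≡ a) → Fin q
        slopeIf (yes _) = t₀
        slopeIf {u} (no _) = (tangent u ⊝ v) ⊗ inv (u ⊝ a)

        -- The slope of the line joining (a , v) to the tangent point of the column u.
        slope : Fin q → Fin q
        slope u = slopeIf (u ≟ᶠ a)

        slope-a : slope a ≡ t₀
        slope-a with a ≟ᶠ a
        ... | yes _ = refl
        ... | no a≢a = contradiction refl a≢a

        slope-≢ : ∀ {u} → ¬ (u ≡ a) → slope u ≡ (tangent u ⊝ v) ⊗ inv (u ⊝ a)
        slope-≢ {u} u≢a = cases (u ≟ᶠ a)
          where
          cases : (d : Dec (u ≡ a)) → slopeIf d ≡ (tangent u ⊝ v) ⊗ inv (u ⊝ a)
          cases (yes u≡a) = contradiction u≡a u≢a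
          cases (no _) = refl

        -- A line through (a , v) of another slope t has even total q - 1, of which (a , v)
        -- contributes 1, so some other point of it is odd, that is, tangent.
        line-tangent : ∀ t → ¬ (v ≡ t ⊗ a ⊕ c t) → ∃ λ u → ¬ (u ≡ a) × N u (t ⊗ u ⊕ (v ⊝ t ⊗ a)) ≡ 1
        line-tangent t v≢ with any? (λ u → ¬? (u ≟ᶠ a) ×-dec (N u (t ⊗ u ⊕ (v ⊝ t ⊗ a)) ≟ 1))
        ... | yes found = found
        ... | no none = contradiction (subst (2 ∣_) total (∑-∣ 2 f (λ u → even u (u ≟ᶠ a)))) q-odd
          where
          d = v ⊝ t ⊗ a
          -- The extra `δ u a` raises the term at u = a from 1 to 2. Without a tangent point every
          -- term would be even, while the total is the odd number `q`.
          f : Fin q → ℕ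
          f u = N u (t ⊗ u ⊕ d) + δ u a
          even : ∀ u → Dec (u ≡ a) → 2 ∣ f u
          even u (yes refl) = divides 1 (cong₂ _+_ (trans (cong (N a) (⊕-⊝′ v (t ⊗ a))) simple) (δ-refl a))
          even u (no u≢a) = ∣m∣n⇒∣m+n
            (≤2∧≢1⇒even (N≤2 u _ u≢a) (λ N≡1 → none (u , u≢a , N≡1)))
            (subst (2 ∣_) (sym (δ-≢ u≢a)) (2 ∣0))
          d≢ct : ¬ (d ≡ c t)
          d≢ct d≡ct = v≢ (trans (sym (⊕-⊝′ v (t ⊗ a))) (cong (t ⊗ a ⊕_) d≡ct))
          open ≡-Reasoning
          total : ∑[ u < q ] f u ≡ q
          total = begin
            ∑[ u < q ] f u                                    ≡⟨ ∑-distrib-+ (λ u → N u (t ⊗ u ⊕ d)) (λ u → δ u a) ⟩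
            ∑[ u < q ] N u (t ⊗ u ⊕ d) + ∑[ u < q ] δ u a     ≡⟨ cong (∑[ u < q ] N u (t ⊗ u ⊕ d) +_) (∑-δ-1 a) ⟩
            ∑[ u < q ] N u (t ⊗ u ⊕ d) + 1                    ≡⟨ ∑-line t d ⟩
            q + q * δ d (c t)                                 ≡⟨ cong (λ k → q + q * k) (δ-≢ d≢ct) ⟩
            q + q * 0                                         ≡⟨ cong (q +_) (*-zeroʳ q) ⟩
            q + 0                                             ≡⟨ +-identityʳ q ⟩
            q                                                 ∎

        -- The slope `t₀` is taken at u = a by definition; any other `t` is taken at the tangent
        -- point that `line-tangent` finds on the line of slope `t` through (a, v).
        slope-surjective : ∀ t → ∃ λ u → slope u ≡ t
        slope-surjective t with v ≟ᶠ (t ⊗ a ⊕ c t)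
        ... | yes v≡ = a , trans slope-a (t₀-unique t v≡)
        ... | no v≢ with line-tangent t v≢
        ... | u , u≢a , N≡1 = u , (begin
          slope u                                             ≡⟨ slope-≢ u≢a ⟩
          (tangent u ⊝ v) ⊗ inv (u ⊝ a)                       ≡⟨ cong (λ w → (w ⊝ v) ⊗ inv (u ⊝ a)) (tangent-≡ u≢a _ N≡1) ⟩
          ((t ⊗ u ⊕ (v ⊝ t ⊗ a)) ⊝ v) ⊗ inv (u ⊝ a)           ≡⟨ cong (_⊗ inv (u ⊝ a)) rise ⟩
          t ⊗ (u ⊝ a) ⊗ inv (u ⊝ a)                           ≡⟨ R.*-assoc t _ _ ⟩
          t ⊗ ((u ⊝ a) ⊗ inv (u ⊝ a))                         ≡⟨ cong (t ⊗_) (⊗-inv (⊝≢0 u≢a)) ⟩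
          t ⊗ 1F                                              ≡⟨ R.*-identityʳ t ⟩
          t                                                   ∎)
          where
          open ≡-Reasoning
          rise : (t ⊗ u ⊕ (v ⊝ t ⊗ a)) ⊝ v ≡ t ⊗ (u ⊝ a)
          rise = begin
            (t ⊗ u ⊕ (v ⊝ t ⊗ a)) ⊝ v    ≡⟨ cong (λ z → (t ⊗ u ⊕ z) ⊝ v) (R.+-comm v _) ⟩
            (t ⊗ u ⊕ (⊖ (t ⊗ a) ⊕ v)) ⊝ v  ≡⟨ cong (_⊝ v) (R.+-assoc _ _ _) ⟨
            (t ⊗ u ⊝ t ⊗ a ⊕ v) ⊝ v      ≡⟨ ⊕-⊝ _ v ⟩
            t ⊗ u ⊝ t ⊗ a                ≡⟨ RP.x[y-z]≈xy-xz t u a ⟨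
            t ⊗ (u ⊝ a)                  ∎

        ∑-slope : ΣF.sum slope ≡ ΣF.sum id
        ∑-slope = sym (ΣF.sum-permute id
          (surjective⇒permutation slope (proj₁ ∘ slope-surjective) (proj₂ ∘ slope-surjective)))

      -- Both slope functions permute the field and so have equal sums. Off u = a they differ by (v′
      -- - v)/(u - a), which sums to 0, so they agree at u = a too. Then one line of the
      -- configuration passes through both points, and it meets the column once.
      simple-unique : ∀ v v′ → N a v ≡ 1 → N a v′ ≡ 1 → v ≡ v′
      simple-unique v v′ p p′ =
        trans (proj₂ A.line-through) (trans (cong (λ t → t ⊗ a ⊕ c t) t₀≡) (sym (proj₂ B.line-through)))
        where
        module A = SimplePoint v p
        module B = SimplePoint v′ p′
        open ≡-Reasoning
        correction : Fin q → Fin q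
        correction u = (v′ ⊝ v) ⊗ inv (u ⊝ a)
        -- The default `inv-0` matters here: the sum of inverses runs over all `u`, including u = a.
        correction-a : correction a ≡ 0F
        correction-a = trans (cong (λ z → (v′ ⊝ v) ⊗ inv z) (R.-‿inverseʳ a))
          (trans (cong ((v′ ⊝ v) ⊗_) inv-0) (R.zeroʳ _))
        agree : ∀ u → ¬ (u ≡ a) → A.slope u ≡ B.slope u ⊕ correction u
        agree u u≢a = begin
          A.slope u                                                      ≡⟨ A.slope-≢ u≢a ⟩
          (tangent u ⊝ v) ⊗ inv (u ⊝ a)                                  ≡⟨ cong (_⊗ inv (u ⊝ a)) (⊝-telescope (tangent u) v′ v) ⟩
          ((tangent u ⊝ v′) ⊕ (v′ ⊝ v)) ⊗ inv (u ⊝ a)                    ≡⟨ R.distribʳ _ _ _ ⟩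
          (tangent u ⊝ v′) ⊗ inv (u ⊝ a) ⊕ correction u                  ≡⟨ cong (_⊕ correction u) (B.slope-≢ u≢a) ⟨
          B.slope u ⊕ correction u                                       ∎
        same-sum : ΣF.sum A.slope ≡ ΣF.sum (λ u → B.slope u ⊕ correction u)
        same-sum = begin
          ΣF.sum A.slope                          ≡⟨ trans A.∑-slope (sym B.∑-slope) ⟩
          ΣF.sum B.slope                          ≡⟨ R.+-identityʳ _ ⟨
          ΣF.sum B.slope ⊕ 0F                     ≡⟨ cong (ΣF.sum B.slope ⊕_) (sum-scaled-inverses≡0 h q≡1+2h (v′ ⊝ v) a) ⟨
          ΣF.sum B.slope ⊕ ΣF.sum correction      ≡⟨ ΣF.∑-distrib-+ B.slope correction ⟨
          ΣF.sum (λ u → B.slope u ⊕ correction u) ∎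
        t₀≡ : A.t₀ ≡ B.t₀
        t₀≡ = begin
          A.t₀                         ≡⟨ A.slope-a ⟨
          -- Equal sums of functions that agree off `a` leave equal values at `a`.
          A.slope a                    ≡⟨ RP.+-cancelˡ _ _ _ (trans (sym (sum-agree-off R.+-commutativeMonoid A.slope _ a agree)) (cong (_⊕ (B.slope a ⊕ correction a)) same-sum)) ⟩
          B.slope a ⊕ correction a     ≡⟨ cong₂ _⊕_ B.slope-a correction-a ⟩
          B.t₀ ⊕ 0F                    ≡⟨ R.+-identityʳ _ ⟩
          B.t₀                         ∎

      -- The defects of the column u = a are part of the total `h`, and there N² is N plus twice the
      -- defect.
      ∑-squares-a : ∑[ v < q ] (N a v * N a v) ≤ q + h * 2
      ∑-squares-a = begin
        ∑[ v < q ] (N a v * N a v)                            ≡⟨ sum-cong-≗ (λ v → defect-suc (N a v)) ⟩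
        ∑[ v < q ] (N a v + defect (suc (N a v)) * 2)         ≡⟨ ∑-distrib-+ (N a) _ ⟩
        ∑[ v < q ] N a v + ∑[ v < q ] (defect (suc (N a v)) * 2)
          ≡⟨ cong₂ _+_ (∑-column a) (sym (*-distribʳ-sum 2 (λ v → defect (suc (N a v))))) ⟩
        q + ∑[ v < q ] defect (suc (N a v)) * 2               ≡⟨ cong (λ k → q + k * 2) (sum-cong-≗ (λ v → cong (λ e → defect (e + N a v)) (sym (δ-refl a)))) ⟩
        q + ∑[ v < q ] defect (δ a a + N a v) * 2             ≤⟨ +-monoʳ-≤ q (*-monoˡ-≤ 2 (≤∑ (λ u → ∑[ v < q ] defect (δ u a + N u v)) a)) ⟩
        q + totalDefect * 2                                   ≡⟨ cong (λ k → q + k * 2) totalDefect≡h ⟩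
        q + h * 2                                             ∎
        where open ≤-Reasoning

      -- With at most one simple point, N² + [N = 1] sums to at most q + 2h + 1 = 2q, the sum of 2N.
      -- The termwise inequality is therefore an equality at every `v`, which excludes N > 2.
      N-a≤2 : ∀ v → N a v ≤ 2
      N-a≤2 v = n²+⟦n≡1⟧≤2n⇒n≤2 (N a v) (∑-tight (λ v → N a v + N a v) (λ v → N a v * N a v + ⟦ N a v ≟ 1 ⟧)
        (λ v → 2n≤n²+⟦n≡1⟧ (N a v)) (begin
          ∑[ v < q ] (N a v * N a v + ⟦ N a v ≟ 1 ⟧)                    ≡⟨ ∑-distrib-+ (λ v → N a v * N a v) _ ⟩
          ∑[ v < q ] (N a v * N a v) + ∑[ v < q ] ⟦ N a v ≟ 1 ⟧         ≤⟨ +-mono-≤ ∑-squares-a (∑-subsingleton (λ v → N a v ≟ 1) simple-unique) ⟩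
          q + h * 2 + 1                                                 ≡⟨ +-assoc q _ 1 ⟩
          q + (h * 2 + 1)                                               ≡⟨ cong (q +_) (trans (+-comm _ 1) (sym q≡1+2h)) ⟩
          q + q                                                         ≡⟨ cong₂ _+_ (∑-column a) (∑-column a) ⟨
          ∑[ v < q ] N a v + ∑[ v < q ] N a v                           ≡⟨ ∑-distrib-+ (N a) (N a) ⟨
          ∑[ v < q ] (N a v + N a v)                                    ∎) v)
        where open ≤-Reasoning

      multiplicity≤3 : ∀ u v → δ u a + N u v ≤ 3
      multiplicity≤3 u v = cases (u ≟ᶠ a)
        where
        cases : Dec (u ≡ a) → δ u a + N u v ≤ 3
        cases (yes refl) rewrite δ-refl a = s≤s (N-a≤2 v)
        cases (no u≢a) rewrite δ-≢ u≢a = m≤n⇒m≤1+n (N≤2 u v u≢a)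

-- Multiplicities and changes of coordinates

sum-map-allFin : ∀ {n} (f : Fin n → ℕ) → sumᴸ (map f (allFin n)) ≡ ∑[ i < n ] f i
sum-map-allFin f = trans (cong sumᴸ (map-tabulate id f)) (sum-tabulate f)

module Configuration {q : ℕ} (F : FiniteField q) (b : Maybe (Fin q) → Fin q) where
  open FieldProperties F
  open LineCounting F using (N; module Bound)

  m : Point F → ℕ
  m = mult F b

  ∑-points : (f : Point F → ℕ) → sumᴸ (map f (points F)) ≡ ∑[ x < q ] ∑[ y < q ] f (x , y)
  ∑-points f = begin
    sumᴸ (map f (points F))                                               ≡⟨ sum-map-cartesianProduct f (allFin q) (allFin q) ⟩
    sumᴸ (map (λ x → sumᴸ (map (λ y → f (x , y)) (allFin q))) (allFin q))  ≡⟨ sum-map-allFin (λ x → sumᴸ (map (λ y → f (x , y)) (allFin q))) ⟩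
    ∑[ x < q ] sumᴸ (map (λ y → f (x , y)) (allFin q))                    ≡⟨ sum-cong-≗ (λ x → sum-map-allFin (λ y → f (x , y))) ⟩
    ∑[ x < q ] ∑[ y < q ] f (x , y)                                       ∎
    where open ≡-Reasoning

  mult-∑ : ∀ x y → m (x , y) ≡ δ x (b nothing) + N (b ∘ just) x y
  mult-∑ x y = trans (length-filter-sum (λ i → onLine? F i (b i) (x , y)) (slopes F))
    (cong (δ x (b nothing) +_) (trans (cong sumᴸ (sym (map-∘ (allFin q)))) (sum-map-allFin (λ t → δ y (t ⊗ x ⊕ b (just t))))))

  excess-∑ : excess F b ≡ ∑[ x < q ] ∑[ y < q ] defect (m (x , y))
  excess-∑ = trans (sum-map-filter (inB? F b) (defect ∘ m) outside (points F)) (∑-points (defect ∘ m))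
    where
    outside : ∀ P → ¬ (1 ≤ m P) → defect (m P) ≡ 0
    outside P ¬1≤m rewrite n≤0⇒n≡0 (≤-pred (≰⇒> ¬1≤m)) = refl

  countMult3-∑ : countMult3 F b ≡ ∑[ x < q ] ∑[ y < q ] ⟦ m (x , y) ≟ 3 ⟧
  countMult3-∑ = trans (length-filter-sum (λ P → m P ≟ 3) (pointsOfB F b))
    (trans (sum-map-filter (inB? F b) (λ P → ⟦ m P ≟ 3 ⟧) outside (points F)) (∑-points _))
    where
    outside : ∀ P → ¬ (1 ≤ m P) → ⟦ m P ≟ 3 ⟧ ≡ 0
    outside P ¬1≤m = ⟦⟧-no (m P ≟ 3) λ m≡3 → ¬1≤m (subst (1 ≤_) (sym m≡3) (s≤s z≤n))

  Conclusion : ℕ → Set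
  Conclusion h = (h ≤ excess F b)
    × ((excess F b ≡ h) ⇔ ((countMult3 F b ≡ h) × (∀ P → 1 ≤ m P → ¬ (3 < m P))))

  excess≡countMult3 : (∀ P → m P ≤ 3) → excess F b ≡ countMult3 F b
  excess≡countMult3 m≤3 = trans excess-∑ (trans
    (sum-cong-≗ (λ x → sum-cong-≗ (λ y → defect≡⟦≡3⟧ (m (x , y)) (m≤3 (x , y)))))
    (sym countMult3-∑))

  -- Once all multiplicities are at most 3, excess and number of triple points coincide. Both
  -- directions of the equivalence follow from this.
  conclusion : ∀ h → h ≤ excess F b → (excess F b ≡ h → ∀ P → m P ≤ 3) → Conclusion h
  conclusion h bound equality = bound , mk⇔
    (λ e → trans (sym (excess≡countMult3 (equality e))) e , λ P _ → ≤⇒≯ (equality e P))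
    (λ { (count≡h , none) → trans (excess≡countMult3 (m≤3 none)) count≡h })
    where
    m≤3 : (∀ P → 1 ≤ m P → ¬ (3 < m P)) → ∀ P → m P ≤ 3
    m≤3 none P with m P ≤? 3
    ... | yes le = le
    ... | no nle = contradiction (≰⇒> nle) (none P (≤-trans (s≤s z≤n) (≰⇒> nle)))

  -- φ is a change of coordinates that takes ℓ(j, b_j) to the vertical line u = a and the
  -- remaining lines to the lines v = t u + c t.
  from-coordinates :
    ∀ h → q ≡ suc (h * 2) → (φ : Fin q → Fin q → Point F) → (∀ P → ∃ λ u → ∃ λ v → φ u v ≡ P) →
    (∀ (f : Point F → ℕ) → ∑[ x < q ] ∑[ y < q ] f (x , y) ≡ ∑[ u < q ] ∑[ v < q ] f (φ u v)) →
    (a : Fin q) (c : Fin q → Fin q) → (∀ u v → m (φ u v) ≡ δ u a + N c u v) →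
    (∀ u v → 3 ≤ m (φ u v) → u ≡ a) → Conclusion h
  from-coordinates h q≡ φ φ-surjective reindex a c mult-φ heavy =
    conclusion h (subst (h ≤_) (sym excess≡) Counting.h≤totalDefect) m≤3
    where
    -- Three lines other than the distinguished one already make a point heavy, which puts it on u =
    -- a.
    N≤2 : ∀ u v → ¬ (u ≡ a) → N c u v ≤ 2
    N≤2 u v u≢a with N c u v ≤? 2
    ... | yes le = le
    ... | no nle = contradiction
      (heavy u v (subst (3 ≤_) (sym (mult-φ u v)) (≤-trans (≰⇒> nle) (m≤n+m _ (δ u a))))) u≢a
    module Counting = Bound c h q≡ a N≤2
    excess≡ : excess F b ≡ Counting.totalDefect
    excess≡ = trans excess-∑ (trans (reindex (defect ∘ m))
      (sum-cong-≗ (λ u → sum-cong-≗ (λ v → cong defect (mult-φ u v)))))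
    m≤3 : excess F b ≡ h → ∀ P → m P ≤ 3
    m≤3 e P with φ-surjective P
    ... | u , v , refl = subst (_≤ 3) (sym (mult-φ u v)) (Counting.Equality.multiplicity≤3 (trans (sym excess≡) e) u v)

  -- Coordinates for a distinguished line of finite slope

  module FiniteSlope (j : Fin q) where

    ordinate : Fin q → Fin q
    ordinate x = j ⊗ x ⊕ b (just j)

    -- Here `u` is the height above the distinguished line, which becomes u = 0, and `v` is the old
    -- abscissa, so the old vertical line becomes a line of slope 0.
    φ : Fin q → Fin q → Point F
    φ u v = v , u ⊕ ordinate v

    φ-surjective : ∀ P → ∃ λ u → ∃ λ v → φ u v ≡ P
    φ-surjective (x , y) = y ⊝ ordinate x , x , cong (x ,_) (⊝-⊕ y (ordinate x))

    reindex : ∀ (f : Point F → ℕ) → ∑[ x < q ] ∑[ y < q ] f (x , y) ≡ ∑[ u < q ] ∑[ v < q ] f (φ u v)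
    reindex f = trans (sum-cong-≗ (λ x → ∑-permute (λ y → f (x , y)) (translation (ordinate x))))
      (∑-comm (λ v u → f (φ u v)))

    -- Substituting y = u + j v + d into y = (j + 1/t) v + e and solving for `v` gives v = t u + t(d
    -- - e).
    interceptIf : ∀ {t} → Dec (t ≡ 0F) → Fin q
    interceptIf (yes _) = b nothing
    interceptIf {t} (no _) = t ⊗ (b (just j) ⊝ b (just (j ⊕ inv t)))

    -- In the coordinates (u , v), the line of slope j + 1/t has slope t, and the vertical line slope 0.
    intercept : Fin q → Fin q
    intercept t = interceptIf (t ≟ᶠ 0F)

    intercept-0 : intercept 0F ≡ b nothing
    intercept-0 with 0F ≟ᶠ 0F
    ... | yes _ = refl
    ... | no 0≢0 = contradiction refl 0≢0

    intercept-≢ : ∀ {t} → ¬ (t ≡ 0F) → intercept t ≡ t ⊗ (b (just j) ⊝ b (just (j ⊕ inv t)))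
    intercept-≢ {t} t≢0 = cases (t ≟ᶠ 0F)
      where
      cases : (d : Dec (t ≡ 0F)) → interceptIf d ≡ t ⊗ (b (just j) ⊝ b (just (j ⊕ inv t)))
      cases (yes t≡0) = contradiction t≡0 t≢0
      cases (no _) = refl

    module _ (u v t : Fin q) (t≢0 : ¬ (t ≡ 0F)) where
      private
        e = b (just (j ⊕ inv t))
        d = b (just j)

      image-line : t ⊗ u ⊕ intercept t ≡ t ⊗ (u ⊕ (d ⊝ e))
      image-line = trans (cong (t ⊗ u ⊕_) (intercept-≢ t≢0)) (sym (R.distribˡ t u (d ⊝ e)))

      -- Together with `right-form` this exposes the common summand `j ⊗ v ⊕ e`; cancelling it
      -- leaves u + (d - e) = v/t.
      left-form : u ⊕ ordinate v ≡ (u ⊕ (d ⊝ e)) ⊕ (j ⊗ v ⊕ e)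
      left-form = begin
        u ⊕ (j ⊗ v ⊕ d)                 ≡⟨ cong (λ z → u ⊕ (j ⊗ v ⊕ z)) (⊝-⊕ d e) ⟨
        u ⊕ (j ⊗ v ⊕ ((d ⊝ e) ⊕ e))     ≡⟨ cong (u ⊕_) (R.+-assoc _ _ _) ⟨
        u ⊕ (j ⊗ v ⊕ (d ⊝ e) ⊕ e)       ≡⟨ cong (λ z → u ⊕ (z ⊕ e)) (R.+-comm _ _) ⟩
        u ⊕ ((d ⊝ e) ⊕ j ⊗ v ⊕ e)       ≡⟨ cong (u ⊕_) (R.+-assoc _ _ _) ⟩
        u ⊕ ((d ⊝ e) ⊕ (j ⊗ v ⊕ e))     ≡⟨ R.+-assoc _ _ _ ⟨
        (u ⊕ (d ⊝ e)) ⊕ (j ⊗ v ⊕ e)     ∎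
        where open ≡-Reasoning

      right-form : (j ⊕ inv t) ⊗ v ⊕ e ≡ inv t ⊗ v ⊕ (j ⊗ v ⊕ e)
      right-form = trans (cong (_⊕ e) (trans (R.distribʳ v j (inv t)) (R.+-comm _ _))) (R.+-assoc _ _ _)

      to-image : u ⊕ ordinate v ≡ (j ⊕ inv t) ⊗ v ⊕ e → v ≡ t ⊗ u ⊕ intercept t
      to-image eq = sym (trans image-line (trans
        (cong (t ⊗_) (⊕-cancelʳ (j ⊗ v ⊕ e) _ _ (trans (sym left-form) (trans eq right-form))))
        (⊗-inv-cancel t≢0 v)))

      from-image : v ≡ t ⊗ u ⊕ intercept t → u ⊕ ordinate v ≡ (j ⊕ inv t) ⊗ v ⊕ e
      from-image eq = trans left-form (trans
        (cong (_⊕ (j ⊗ v ⊕ e)) (sym (trans (cong (inv t ⊗_) (trans eq image-line)) (inv-⊗-cancel t≢0 _))))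
        (sym right-form))

    ordinate-cancel : ∀ u v → u ⊕ ordinate v ≡ ordinate v → u ≡ 0F
    ordinate-cancel u v eq = ⊕-cancelʳ (ordinate v) u 0F (trans eq (sym (R.+-identityˡ _)))

    -- Reindexing the slopes by j + 1/t matches old and new lines for t ≠ 0. At t = 0 the old sum
    -- has the distinguished line and the new one has the old vertical line; `sum-agree-off`
    -- exchanges the two.
    mult-φ : ∀ u v → m (φ u v) ≡ δ u 0F + N intercept u v
    mult-φ u v = begin
      m (φ u v)                                  ≡⟨ mult-∑ v (u ⊕ ordinate v) ⟩
      δ v (b nothing) + ∑[ s < q ] δ (u ⊕ ordinate v) (s ⊗ v ⊕ b (just s))
        ≡⟨ cong (δ v (b nothing) +_) (∑-permute _ (translated-inversion j)) ⟩
      δ v (b nothing) + ∑[ t < q ] old t         ≡⟨ +-comm (δ v (b nothing)) _ ⟩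
      ∑[ t < q ] old t + δ v (b nothing)         ≡⟨ cong (sum old +_) new-0 ⟨
      ∑[ t < q ] old t + new 0F                  ≡⟨ sum-agree-off +-0-commutativeMonoid old new 0F agree ⟩
      ∑[ t < q ] new t + old 0F                  ≡⟨ +-comm (sum new) _ ⟩
      old 0F + ∑[ t < q ] new t                  ≡⟨ cong (_+ sum new) old-0 ⟩
      δ u 0F + N intercept u v                   ∎
      where
      open ≡-Reasoning
      old new : Fin q → ℕ
      old t = δ (u ⊕ ordinate v) ((j ⊕ inv t) ⊗ v ⊕ b (just (j ⊕ inv t)))
      new t = δ v (t ⊗ u ⊕ intercept t)
      agree : ∀ t → ¬ (t ≡ 0F) → old t ≡ new t
      agree t t≢0 = ⟦⟧-cong (_ ≟ᶠ _) (_ ≟ᶠ _) (to-image u v t t≢0) (from-image u v t t≢0)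
      new-0 : new 0F ≡ δ v (b nothing)
      new-0 = cong (δ v) (trans (cong₂ _⊕_ (R.zeroˡ u) intercept-0) (R.+-identityˡ _))
      old-0 : old 0F ≡ δ u 0F
      old-0 = trans
        (cong (λ s → δ (u ⊕ ordinate v) (s ⊗ v ⊕ b (just s))) (trans (cong (j ⊕_) inv-0) (R.+-identityʳ j)))
        (⟦⟧-cong (_ ≟ᶠ _) (_ ≟ᶠ _) (ordinate-cancel u v) (λ { refl → R.+-identityˡ _ }))

  conclusion-for : ∀ h → q ≡ suc (h * 2) →
    (j : Maybe (Fin q)) → (∀ P → 3 ≤ m P → OnLine F j (b j) P) → Conclusion h
  conclusion-for h q≡ nothing heavy =
    from-coordinates h q≡ _,_ (λ { (x , y) → x , y , refl }) (λ _ → refl)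
      (b nothing) (b ∘ just) mult-∑ (λ u v → heavy (u , v))
  conclusion-for h q≡ (just j) heavy =
    from-coordinates h q≡ φ φ-surjective reindex 0F intercept mult-φ
      (λ u v 3≤m → ordinate-cancel u v (heavy (φ u v) 3≤m))
    where open FiniteSlope j

theorem2 : (q : ℕ) → IsPrimePower q → q % 2 ≡ 1 → (F : FiniteField q)
    → (b : Maybe (Fin q) → Fin q)
    → (∃ λ j → ∀ P → 1 ≤ mult F b P → 3 ≤ mult F b P → OnLine F j (b j) P)
    → ((q ∸ 1) / 2 ≤ excess F b)
    × ((excess F b ≡ (q ∸ 1) / 2)
    ⇔ ((countMult3 F b ≡ (q ∸ 1) / 2) × (∀ P → 1 ≤ mult F b P → ¬ (3 < mult F b P))))
-- The counting is done with h = q / 2 and q = 1 + 2h; a point with multiplicity at least 3 lies in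
-- B.
theorem2 q _ q%2≡1 F b (j , heavy) = subst Conclusion (sym half)
  (conclusion-for (q / 2) q≡ j (λ P 3≤m → heavy P (≤-trans (s≤s z≤n) 3≤m) 3≤m))
  where
  open Configuration F b
  q≡ : q ≡ suc (q / 2 * 2)
  q≡ = trans (m≡m%n+[m/n]*n q 2) (cong (_+ q / 2 * 2) q%2≡1)
  half : (q ∸ 1) / 2 ≡ q / 2
  half = trans (cong (λ n → (n ∸ 1) / 2) q≡) (m*n/n≡m (q / 2) 2)
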